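{- Fix a good basis of $2^\omega$. (a) There exists a continuous injection $I:2^\omega\rightarrow\mathcal{B}_1(2^\omega,2)$ such that $I[2^\omega]$ is not uniformly recoverable, and in fact such that the evaluation map $\phi:2^\omega\times I[2^\omega]\to 2$, $\phi(x,f)=f(x)$, is not Baire class one. (b) There exists $A\subseteq\mathcal{B}_1(2^\omega,2)$, homeomorphic to $\omega^\omega$, which is not uniformly recoverable and such that the evaluation map $\phi:2^\omega\times A\to 2$, $\phi(x,f)=f(x)$, is Baire class one.
   Context: $2=\{0,1\}$ is discrete. For topological spaces $X,Y$, a function $f:X\to Y$ is Baire class one if $f^{ -1}(U)$ is $F_\sigma$ for every open $U\subseteq Y$; $\mathcal{B}_1(X,Y)$ is the set of such functions, equipped with the topology of pointwise convergence; its subsets carry the subspace topology. A basis $(W_m)_{m\in\omega}$ for the topology of $X$ is a good basis if for each open $U\subseteq X$ and each $x\in U$ there is $m_0$ such that for all $m\geq m_0$: if $x\in W_m$ then $W_m\subseteq U$. Fix a good basis $(W_m)$ of $X$. For a dense sequence $D=(x_p)_{p\in\omega}$ in $X$ and $x\in X$, define: $s_0[x,D]:=x_0$; $s_{n+1}[x,D]:=s_n[x,D]$ if $x=s_n[x,D]$; otherwise $s_{n+1}[x,D]:=x_p$, where $p$ is least such that there exists $m$ with $\{x,x_p\}\subseteq W_m\subseteq X\setminus\{s_0[x,D],\ldots,s_n[x,D]\}$. $f:X\to Y$ is recoverable with respect to $D$ if $f(s_n[x,D])\to f(x)$ for each $x\in X$. $A\subseteq\mathcal{B}_1(X,Y)$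 is uniformly recoverable if there is a dense sequence $D$ of $X$ such that every $f\in A$ is recoverable with respect to $D$. -}

module Defs where

open import Axiom.ExcludedMiddle using (ExcludedMiddle)
open import Data.Bool.Base using (Bool)
open import Data.List.Base using (List; []; _∷_; _++_)
open import Data.List.Relation.Unary.All as All using (All; []; _∷_)
open import Data.List.Relation.Unary.All.Properties using (++⁺; ++⁻ˡ; ++⁻ʳ)
open import Data.Nat.Base using (ℕ; zero; suc; _≤_; _<_)
open import Data.Nat.Induction using (<-rec)
open import Data.Product using (∃; Σ; _×_; _,_; proj₁; proj₂)
open import Data.Product.Relation.Binary.Pointwise.NonDependent using (_×ₛ_)
open import Data.Sum.Base using (_⊎_; inj₁; inj₂; [_,_]′)
open import Data.Unit.Base using (⊤; tt)
open import Data.Vec.Base using (Vec; []; _∷_; head)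
open import Data.Vec.Relation.Unary.Any using (here; there)
import Data.Vec.Membership.Setoid as VecMembership
open import Function.Base using (_∘_)
open import Function.Bundles using (Func; Inverse; Injection)
open import Function.Relation.Binary.Setoid.Equality using (_⇨_)
open import Level using (Level; 0ℓ; _⊔_) renaming (suc to lsuc)
open import Relation.Binary.Bundles using (Setoid)
open import Relation.Binary.Definitions using (_Respects_)
open import Relation.Binary.PropositionalEquality as ≡ using (_≡_; _→-setoid_)
import Relation.Binary.Construct.On as On
open import Relation.Nullary using (¬_; yes; no; contradiction)
open import Relation.Unary using (Pred; _∈_; _⊆_; _≐_; _⊢_; _∩_; ∁; ⋃; U)

private
  variable
    a b c c′ i o o′ : Level

-- Points live in a setoid, so that points of ℕ → Bool are compared pointwise.
-- Subsets are predicates valued in Set₀; under excluded middle every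
-- proposition is equivalent to one in Set₀, so this loses no subsets.
-- `open-local` is closure under arbitrary unions, phrased so as not to fix
-- the universe of the index set; it also makes `Open` invariant under _≐_.
record Space c o : Set (lsuc (c ⊔ o ⊔ lsuc 0ℓ)) where
  field
    setoid : Setoid c 0ℓ
  open Setoid setoid public
  field
    Open       : Pred Carrier 0ℓ → Set o
    open-resp  : ∀ {O} → Open O → O Respects _≈_
    open-U     : Open U
    open-∩     : ∀ {O O′} → Open O → Open O′ → Open (O ∩ O′)
    open-local : ∀ {O} → (∀ x → x ∈ O → ∃ λ V → Open V × x ∈ V × V ⊆ O) → Open O

open Space using (Carrier; setoid; Open)

Closed : (X : Space c o) → Pred (Carrier X) 0ℓ → Set o
Closed X C = Open X (∁ C)

IsFσ : (X : Space c o) → Pred (Carrier X) 0ℓ → Set (c ⊔ o ⊔ lsuc 0ℓ)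
IsFσ X P = Σ (ℕ → Pred (Carrier X) 0ℓ) λ F → (∀ n → Closed X (F n)) × P ≐ ⋃ ℕ F

Opens : Space c o → Set (c ⊔ o ⊔ lsuc 0ℓ)
Opens X = ∃ (Open X)

module _ (S : Setoid c 0ℓ) {I : Set i} (B : I → Pred (Setoid.Carrier S) 0ℓ)
         (B-resp : ∀ i → B i Respects Setoid._≈_ S) where

  ⋂-finite : List I → Pred (Setoid.Carrier S) i
  ⋂-finite is = λ x → All (λ i → x ∈ B i) is

  -- The topology with subbase B.
  generated : Space c (c ⊔ i)
  generated = record
    { setoid     = S
    ; Open       = GOpen
    ; open-resp  = λ op x≈y x∈O → let is , x∈B , B⊆O = op _ x∈O in
                     B⊆O (All.map (λ {i} → B-resp i x≈y) x∈B)
    ; open-U     = λ _ _ → [] , [] , λ _ → tt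
    ; open-∩     = λ op op′ x (x∈O , x∈O′) →
                     let is , x∈B , B⊆O = op x x∈O ; js , x∈B′ , B′⊆O′ = op′ x x∈O′ in
                     is ++ js , ++⁺ x∈B x∈B′ ,
                     λ all → B⊆O (++⁻ˡ is all) , B′⊆O′ (++⁻ʳ is all)
    ; open-local = λ loc x x∈O →
                     let V , V-open , x∈V , V⊆O = loc x x∈O ; is , x∈B , B⊆V = V-open x x∈V in
                     is , x∈B , V⊆O ∘ B⊆V
    }
    where
    GOpen : Pred (Setoid.Carrier S) 0ℓ → Set (c ⊔ i)
    GOpen O = ∀ x → x ∈ O →
      Σ (List I) λ is → x ∈ ⋂-finite is × (∀ {y} → y ∈ ⋂-finite is → y ∈ O)

discrete : Set → Space 0ℓ 0ℓ
discrete A = record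
  { setoid     = ≡.setoid A
  ; Open       = λ _ → ⊤
  ; open-resp  = λ { _ ≡.refl x∈O → x∈O }
  ; open-U     = tt
  ; open-∩     = λ _ _ → tt
  ; open-local = λ _ → tt
  }

-- A^ω, the product topology of ℕ copies of the discrete space A.
infix 10 _^ω
_^ω : Set → Space 0ℓ (lsuc 0ℓ)
A ^ω = generated (ℕ →-setoid A) {I = ℕ × Opens (discrete A)}
  (λ (n , V , _) α → α n ∈ V)
  (λ (n , V , _) α≗β → ≡.subst V (α≗β n))

_×ᵗ_ : Space c o → Space c′ o′ → Space (c ⊔ c′) (c ⊔ c′ ⊔ o ⊔ o′ ⊔ lsuc 0ℓ)
X ×ᵗ Y = generated (setoid X ×ₛ setoid Y) {I = Opens X ⊎ Opens Y}
  [ (λ (V , _) → proj₁ ⊢ V) , (λ (V , _) → proj₂ ⊢ V) ]′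
  λ { (inj₁ (_ , V-open)) (x≈ , _) → Space.open-resp X V-open x≈
    ; (inj₂ (_ , V-open)) (_ , y≈) → Space.open-resp Y V-open y≈ }

Subspace : (X : Space c o) → Pred (Carrier X) a → Space (c ⊔ a) (c ⊔ a ⊔ o ⊔ lsuc 0ℓ)
Subspace X A = generated (On.setoid (setoid X) (proj₁ {B = A})) {I = Opens X}
  (λ (V , _) → proj₁ ⊢ V)
  (λ (_ , V-open) → Space.open-resp X V-open)

-- All functions X → Y with the topology of pointwise convergence.
Pointwise : (X : Space 0ℓ o) (Y : Space c′ o′) → Space c′ (c′ ⊔ o′ ⊔ lsuc 0ℓ)
Pointwise X Y = generated (setoid X ⇨ setoid Y) {I = Carrier X × Opens Y}
  (λ (x , V , _) f → Func.to f x ∈ V)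
  (λ (x , _ , V-open) f≈g → Space.open-resp Y V-open (f≈g x))

module _ (X : Space c o) (Y : Space c′ o′) where

  Continuous : (Carrier X → Carrier Y) → Set (o ⊔ c′ ⊔ o′ ⊔ lsuc 0ℓ)
  Continuous f = ∀ V → Open Y V → Open X (f ⊢ V)

  Homeomorphic : Set (c ⊔ c′ ⊔ o ⊔ o′ ⊔ lsuc 0ℓ)
  Homeomorphic = Σ (Inverse (setoid X) (setoid Y)) λ h →
    Continuous (Inverse.to h) × (∀ V → Open X V → Open Y (Inverse.from h ⊢ V))

  BaireOne : (Carrier X → Carrier Y) → Set (c ⊔ o ⊔ c′ ⊔ o′ ⊔ lsuc 0ℓ)
  BaireOne f = ∀ V → Open Y V → IsFσ X (f ⊢ V)

module _ (X : Space 0ℓ o) (Y : Space c′ o′) where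

  𝓑₁ : Space (c′ ⊔ o ⊔ o′ ⊔ lsuc 0ℓ) (c′ ⊔ o ⊔ o′ ⊔ lsuc 0ℓ)
  𝓑₁ = Subspace (Pointwise X Y) (λ f → BaireOne X Y (Func.to f))

  evaluation : (A : Pred (Carrier 𝓑₁) a) → Carrier (X ×ᵗ Subspace 𝓑₁ A) → Carrier Y
  evaluation A (x , (f , _) , _) = Func.to f x

Image : (X : Space c o) (Y : Space c′ o′) → Injection (setoid X) (setoid Y) → Pred (Carrier Y) c
Image X Y I y = ∃ λ x → Space._≈_ Y (Injection.to I x) y

module _ (X : Space c o) where

  open Space X using (_≈_)

  record IsGoodBasis (W : ℕ → Pred (Carrier X) 0ℓ) : Set (c ⊔ o ⊔ lsuc 0ℓ) where
    field
      W-open  : ∀ m → Open X (W m)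
      W-basis : ∀ O → Open X O → ∀ x → x ∈ O → ∃ λ m → x ∈ W m × W m ⊆ O
      W-good  : ∀ O → Open X O → ∀ x → x ∈ O →
                ∃ λ m₀ → ∀ m → m₀ ≤ m → x ∈ W m → W m ⊆ O

  Dense : (ℕ → Carrier X) → Set (c ⊔ o ⊔ lsuc 0ℓ)
  Dense D = ∀ O → Open X O → ∃ O → ∃ λ p → D p ∈ O

  ConvergesTo : (ℕ → Carrier X) → Carrier X → Set (c ⊔ o ⊔ lsuc 0ℓ)
  ConvergesTo y l = ∀ V → Open X V → l ∈ V → ∃ λ N → ∀ n → N ≤ n → y n ∈ V

  T₁ : Set (c ⊔ o)
  T₁ = ∀ a → Open X (λ y → ¬ y ≈ a)

Least : Pred ℕ a → Pred ℕ a
Least Q p = Q p × (∀ q → q < p → ¬ Q q)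

module _ (em : ∀ {ℓ} → ExcludedMiddle ℓ) where

  module _ (X : Space 0ℓ o) (W : ℕ → Pred (Carrier X) 0ℓ)
           (D : ℕ → Carrier X) (x : Carrier X) where

    open Space X using (_≈_)
    open VecMembership (setoid X) using () renaming (_∉_ to _∉ᵛ_)

    -- D p may be the next point once those in h have been visited.
    Candidate : ∀ {n} → Vec (Carrier X) n → Pred ℕ 0ℓ
    Candidate h p = ∃ λ m → x ∈ W m × D p ∈ W m × W m ⊆ (_∉ᵛ h)

    -- h lists s_n, …, s_0. The last clause is a junk value: by `next-defined`
    -- and `unvisited` below, it is not reached when X is T₁, W is a basis and
    -- D is dense.
    next : ∀ {n} → Vec (Carrier X) (suc n) → Carrier X
    next h with em {P = x ≈ head h}
    ... | yes _ = head h
    ... | no  _ with em {P = ∃ (Least (Candidate h))}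
    ...   | yes (p , _) = D p
    ...   | no  _       = head h

    history : ∀ n → Vec (Carrier X) (suc n)
    history zero    = D 0 ∷ []
    history (suc n) = next (history n) ∷ history n

    -- s_n[x,D]
    s[_] : ℕ → Carrier X
    s[ n ] = head (history n)

    least : (Q : Pred ℕ a) → ∃ Q → ∃ (Least Q)
    least Q (p , Qp) = <-rec (λ p → Q p → ∃ (Least Q)) step p Qp
      where
      step : ∀ p → (∀ {q} → q < p → Q q → ∃ (Least Q)) → Q p → ∃ (Least Q)
      step p rec Qp with em {P = ∃ λ q → q < p × Q q}
      ... | yes (q , q<p , Qq) = rec q<p Qq
      ... | no  none           = p , Qp , λ q q<p Qq → none (q , q<p , Qq)

    next-defined : T₁ X → IsGoodBasis X W → Dense X D →
                   ∀ {n} (h : Vec (Carrier X) n) → x ∉ᵛ h → ∃ (Least (Candidate h))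
    next-defined t₁ W-gb dense h x∉h =
      let m , x∈W , W⊆ = W-basis _ (avoid h) x x∉h
          p , Dp∈W     = dense (W m) (W-open m) (x , x∈W)
      in least (Candidate h) (p , m , x∈W , Dp∈W , W⊆)
      where
      open IsGoodBasis W-gb
      avoid : ∀ {n} (h : Vec (Carrier X) n) → Open X (_∉ᵛ h)
      avoid []      = Space.open-local X λ _ _ →
        U , Space.open-U X , tt , λ _ ()
      avoid (a ∷ h) = Space.open-local X λ y y∉ →
        _ , Space.open-∩ X (t₁ a) (avoid h) , (y∉ ∘ here , y∉ ∘ there) ,
        λ { (z≉a , _) (here z≈a) → z≉a z≈a ; (_ , z∉h) (there z∈h) → z∉h z∈h }

    unvisited : ∀ n → ¬ x ≈ s[ n ] → x ∉ᵛ history n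
    unvisited zero    x≉ (here x≈)  = x≉ x≈
    unvisited (suc n) x≉ (here x≈)  = x≉ x≈
    unvisited (suc n) x≉ (there x∈) with em {P = x ≈ s[ n ]}
    ... | yes x≈  = x≉ x≈
    ... | no  x≉′ = unvisited n x≉′ x∈

  module _ (X : Space 0ℓ o) (Y : Space c′ o′) (W : ℕ → Pred (Carrier X) 0ℓ) where

    Recoverable : (ℕ → Carrier X) → (Carrier X → Carrier Y) → Set (c′ ⊔ o′ ⊔ lsuc 0ℓ)
    Recoverable D f = ∀ x → ConvergesTo Y (λ n → f (s[_] X W D x n)) (f x)

    UniformlyRecoverable : Pred (Carrier (𝓑₁ X Y)) a → Set (c′ ⊔ o ⊔ o′ ⊔ a ⊔ lsuc 0ℓ)
    UniformlyRecoverable A = Σ (ℕ → Carrier X) λ D → Dense X D ×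
      (∀ (f : Carrier (𝓑₁ X Y)) → f ∈ A → Recoverable D (Func.to (proj₁ f)))

  ^ω-T₁ : ∀ A → T₁ (A ^ω)
  ^ω-T₁ A α β β≉α with em {P = ∃ λ n → ¬ β n ≡ α n}
  ... | yes (n , βn≢αn) =
    (n , (λ v → ¬ v ≡ α n) , tt) ∷ [] , βn≢αn ∷ [] , λ { (≢ ∷ []) γ≗α → ≢ (γ≗α n) }
  ... | no none = contradiction β≗α β≉α
    where
    β≗α : ∀ n → β n ≡ α n
    β≗α n with em {P = β n ≡ α n}
    ... | yes eq = eq
    ... | no neq = contradiction (n , neq) none

Cantor : Space 0ℓ (lsuc 0ℓ)
Cantor = Bool ^ω

Two : Space 0ℓ 0ℓ
Two = discrete Bool

{-# OPTIONS --safe #-}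
module Submission where

-- For α ∈ 2^ω let fun α be the indicator of the set of all prefixes of α that
-- end in a one, continued by zeros. Whether x belongs to this set depends only
-- on α up to the last one of x, so α ↦ fun α is continuous, and it is injective.
-- Let q be a sequence with a last one, listed as D p. Every x close enough to q
-- has q among its s_t[x,D], since no D j with j < p is as close to x as q is.
-- By Baire category some x with infinitely many ones meets infinitely many of its
-- own prefixes, where fun x is 1, although fun x x = 0: no D recovers all fun x.
-- The sequences with infinitely many ones form a copy of ω^ω on which the
-- evaluation is Baire class one; on all of 2^ω its restriction to the diagonal
-- is the indicator of a countable dense set.

open import Defs
open import Axiom.ExcludedMiddle using (ExcludedMiddle)
open import Data.Bool.Base using (Bool; true; false)
open import Data.Bool.Properties using (¬-not)
open import Data.Empty using (⊥)
open import Data.List.Base using (List; []; _∷_)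
open import Data.List.Relation.Unary.All using (All; []; _∷_)
open import Data.Nat.Base
open import Data.Nat.Properties
open import Data.Product using (Σ; ∃; _×_; _,_; proj₁; proj₂)
open import Data.Sum.Base using (_⊎_; inj₁; inj₂; [_,_]′)
open import Data.Unit.Base using (⊤; tt)
open import Data.Vec.Base using (Vec; _∷_; []; head)
import Data.Vec.Membership.Setoid as VecMembership
open import Data.Vec.Relation.Unary.Any using (here; there)
open import Function.Base using (_∘_; id; const)
open import Function.Bundles using (Func; Injection)
open import Level using (Level; 0ℓ)
open import Relation.Binary.Definitions using (_Respects_; tri<; tri≈; tri>)
open import Relation.Binary.PropositionalEquality
open import Relation.Nullary using (¬_; Dec; yes; no; does; contradiction)
open import Relation.Unary using (Pred; _∈_; _⊆_; _⊢_; ∁)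

open Space using (Carrier; Open)

private
  variable
    a b c c′ i o o′ : Level
    A : Set

-- Agreement on initial segments, cylinders, and continuity

infix 4 _≈[_]_
_≈[_]_ : (ℕ → A) → ℕ → (ℕ → A) → Set
α ≈[ n ] β = ∀ i → i < n → α i ≡ β i

≈[]-sym : ∀ n {α β : ℕ → A} → α ≈[ n ] β → β ≈[ n ] α
≈[]-sym _ eq i i<n = sym (eq i i<n)

≈[]-trans : ∀ n {α β γ : ℕ → A} → α ≈[ n ] β → β ≈[ n ] γ → α ≈[ n ] γ
≈[]-trans _ eq eq′ i i<n = trans (eq i i<n) (eq′ i i<n)

≈[]-≤ : ∀ {m n} {α β : ℕ → A} → m ≤ n → α ≈[ n ] β → α ≈[ m ] β
≈[]-≤ m≤n eq i i<m = eq i (<-≤-trans i<m m≤n)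

≈[]-snoc : ∀ n {α β : ℕ → A} → α ≈[ n ] β → α n ≡ β n → α ≈[ suc n ] β
≈[]-snoc n eq eqₙ i i<1+n with m<1+n⇒m<n∨m≡n i<1+n
... | inj₁ i<n  = eq i i<n
... | inj₂ refl = eqₙ

module _ {A : Set} where

  Cylinder : (ℕ → A) → ℕ → List (ℕ × Opens (discrete A))
  Cylinder α zero    = []
  Cylinder α (suc n) = (n , (_≡ α n) , tt) ∷ Cylinder α n

  ∈-Cylinder : ∀ α n → All (λ (i , V , _) → α i ∈ V) (Cylinder α n)
  ∈-Cylinder α zero    = []
  ∈-Cylinder α (suc n) = refl ∷ ∈-Cylinder α n

  Cylinder⇒≈[] : ∀ α n {β} → All (λ (i , V , _) → β i ∈ V) (Cylinder α n) → α ≈[ n ] β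
  Cylinder⇒≈[] α (suc n) (eq ∷ all) = ≈[]-snoc n (Cylinder⇒≈[] α n all) (sym eq)

  cylinders⇒Open : ∀ {O} → (∀ α → α ∈ O → ∃ λ n → ∀ β → α ≈[ n ] β → β ∈ O) → Open (A ^ω) O
  cylinders⇒Open nbhd α α∈O =
    let n , ⊆O = nbhd α α∈O in
    Cylinder α n , ∈-Cylinder α n , λ all → ⊆O _ (Cylinder⇒≈[] α n all)

  Open⇒cylinder : ∀ {O} → Open (A ^ω) O → ∀ α → α ∈ O → ∃ λ n → ∀ β → α ≈[ n ] β → β ∈ O
  Open⇒cylinder op α α∈O =
    let is , α∈ , ⊆O = op α α∈O ; n , ⊆is = bound is α∈ in n , λ β eq → ⊆O (⊆is β eq)
    where
    bound : ∀ is → All (λ (i , V , _) → α i ∈ V) is →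
            ∃ λ n → ∀ β → α ≈[ n ] β → All (λ (i , V , _) → β i ∈ V) is
    bound []                  []          = 0 , λ _ _ → []
    bound ((i , V , _) ∷ is) (αi∈V ∷ all) =
      let n , ⊆is = bound is all in
      suc i ⊔ n , λ β eq →
        subst V (eq i (m≤m⊔n (suc i) n)) αi∈V ∷ ⊆is β (≈[]-≤ (m≤n⊔m (suc i) n) eq)

  Open-ball : ∀ α n → Open (A ^ω) (λ β → α ≈[ n ] β)
  Open-ball α n = cylinders⇒Open λ β α≈β → n , λ γ → ≈[]-trans n α≈β

-- Continuity into `generated S B B-resp`, with its notion of openness unfolded
-- so that B-resp need not be given.
module _ (Z : Space c o) {S : Set c′} {I : Set i} {B : I → Pred S 0ℓ} (g : Carrier Z → S) where

  subbase-continuous : (∀ i → Open Z (g ⊢ B i)) →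
    ∀ V → (∀ y → y ∈ V → Σ (List I) λ is →
             All (λ i → y ∈ B i) is × (∀ {y} → All (λ i → y ∈ B i) is → y ∈ V)) →
    Open Z (g ⊢ V)
  subbase-continuous B-open V V-open = Space.open-local Z λ z z∈V →
    let is , z∈ , ⊆V = V-open (g z) z∈V ; O , O-open , z∈O , O⊆ = nbhd is z z∈ in
    O , O-open , z∈O , λ y∈O → ⊆V (O⊆ y∈O)
    where
    nbhd : ∀ is z → All (λ i → g z ∈ B i) is →
           ∃ λ O → Open Z O × z ∈ O × (∀ {y} → y ∈ O → All (λ i → g y ∈ B i) is)
    nbhd []       z []          = (λ _ → ⊤) , Space.open-U Z , tt , λ _ → []
    nbhd (i ∷ is) z (z∈B ∷ z∈) =
      let O , O-open , z∈O , O⊆ = nbhd is z z∈ in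
      _ , Space.open-∩ Z (B-open i) O-open , (z∈B , z∈O) , λ (y∈B , y∈O) → y∈B ∷ O⊆ y∈O

module _ (X : Space c o) (Y : Space c′ o′) where

  proj₁-continuous : Continuous (X ×ᵗ Y) X proj₁
  proj₁-continuous V V-open z z∈V = inj₁ (V , V-open) ∷ [] , z∈V ∷ [] , λ { (∈V ∷ []) → ∈V }

  proj₂-continuous : Continuous (X ×ᵗ Y) Y proj₂
  proj₂-continuous V V-open z z∈V = inj₂ (V , V-open) ∷ [] , z∈V ∷ [] , λ { (∈V ∷ []) → ∈V }

-- Coding ω^ω by sequences with infinitely many ones

-- The sequence 0^k 1 0^{ν 0} 1 0^{ν 1} 1 …
blocks : ℕ → (ℕ → ℕ) → ℕ → Bool
blocks zero    ν zero    = true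
blocks zero    ν (suc i) = blocks (ν 0) (ν ∘ suc) i
blocks (suc k) ν zero    = false
blocks (suc k) ν (suc i) = blocks k ν i

dec : (ℕ → ℕ) → ℕ → Bool
dec ν = blocks (ν 0) (ν ∘ suc)

-- pos ν j is the place of the j-th one of dec ν, counting from 0.
pos : (ℕ → ℕ) → ℕ → ℕ
pos ν zero    = ν 0
pos ν (suc j) = suc (ν 0 + pos (ν ∘ suc) j)

blocks-skip : ∀ k ν i → blocks k ν (suc (k + i)) ≡ dec ν i
blocks-skip zero    ν i = refl
blocks-skip (suc k) ν i = blocks-skip k ν i

blocks-one : ∀ k ν → blocks k ν k ≡ true
blocks-one zero    ν = refl
blocks-one (suc k) ν = blocks-one k ν

blocks-zero : ∀ k ν i → i < k → blocks k ν i ≡ false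
blocks-zero (suc k) ν zero    _         = refl
blocks-zero (suc k) ν (suc i) (s≤s i<k) = blocks-zero k ν i i<k

dec-drop : ∀ ν j i → dec ν (suc (pos ν j + i)) ≡ dec (ν ∘ (suc j +_)) i
dec-drop ν zero    i = blocks-skip (ν 0) (ν ∘ suc) i
dec-drop ν (suc j) i = begin
  dec ν (suc (suc (ν 0 + pos (ν ∘ suc) j) + i))   ≡⟨ cong (dec ν ∘ suc)
    (trans (cong suc (+-assoc (ν 0) _ i)) (sym (+-suc (ν 0) _))) ⟩
  dec ν (suc (ν 0 + suc (pos (ν ∘ suc) j + i)))   ≡⟨ blocks-skip (ν 0) (ν ∘ suc) _ ⟩
  dec (ν ∘ suc) (suc (pos (ν ∘ suc) j + i))       ≡⟨ dec-drop (ν ∘ suc) j i ⟩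
  dec (ν ∘ (suc (suc j) +_)) i                    ∎
  where open ≡-Reasoning

dec-pos : ∀ ν j → dec ν (pos ν j) ≡ true
dec-pos ν zero    = blocks-one (ν 0) (ν ∘ suc)
dec-pos ν (suc j) = trans (blocks-skip (ν 0) (ν ∘ suc) (pos (ν ∘ suc) j)) (dec-pos (ν ∘ suc) j)

j≤pos : ∀ ν j → j ≤ pos ν j
j≤pos ν zero    = z≤n
j≤pos ν (suc j) = s≤s (≤-trans (j≤pos (ν ∘ suc) j) (m≤n+m _ (ν 0)))

pos-cong : ∀ j {ν μ} → ν ≈[ suc j ] μ → pos ν j ≡ pos μ j
pos-cong zero    eq = eq 0 z<s
pos-cong (suc j) eq =
  cong suc (cong₂ _+_ (eq 0 z<s) (pos-cong j λ i i<j → eq (suc i) (s<s i<j)))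

-- Each entry of `ν` is read only after a one has been put out, so `n` entries settle one place more
-- than `n`.
blocks-cong : ∀ n k {ν μ} → ν ≈[ n ] μ → blocks k ν ≈[ suc n ] blocks k μ
blocks-cong n zero    eq zero    _         = refl
blocks-cong n (suc k) eq zero    _         = refl
blocks-cong (suc n) zero {ν} {μ} eq (suc i) (s<s i<n) rewrite eq 0 z<s =
  blocks-cong n (μ 0) (λ i i<n → eq (suc i) (s<s i<n)) i i<n
blocks-cong (suc n) (suc k) eq (suc i) (s<s i<n) =
  blocks-cong n k (≈[]-≤ (n≤1+n n) eq) i i<n

dec-cong : ∀ n {ν μ} → ν ≈[ n ] μ → dec ν ≈[ n ] dec μ
dec-cong (suc n) {ν} {μ} eq rewrite eq 0 z<s =
  blocks-cong n (μ 0) (λ i i<n → eq (suc i) (s<s i<n))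

blocks-injective : ∀ k l {ν μ} → blocks k ν ≈[ suc k ] blocks l μ → k ≡ l
blocks-injective zero    zero    eq = refl
blocks-injective zero    (suc l) eq with () ← eq 0 z<s
blocks-injective (suc k) zero    eq with () ← eq 0 z<s
blocks-injective (suc k) (suc l) eq =
  cong suc (blocks-injective k l λ i i<k → eq (suc i) (s<s i<k))

-- The gaps can be read off from the places of the ones, one block at a time. This is what makes
-- decoding continuous.
dec-injective : ∀ j {ν μ} → dec ν ≈[ suc (pos ν j) ] dec μ → ν ≈[ suc j ] μ
dec-injective zero    {ν} {μ} eq zero _ = blocks-injective (ν 0) (μ 0) eq
dec-injective zero    eq (suc i) (s<s ())
dec-injective (suc j) {ν} {μ} eq = λ
  { zero    _         → eq₀
  ; (suc i) (s<s i<j) → dec-injective j {ν ∘ suc} {μ ∘ suc} tails i i<j }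
  where
  eq₀ : ν 0 ≡ μ 0
  eq₀ = blocks-injective (ν 0) (μ 0) (≈[]-≤ (s≤s (≤-trans (m≤m+n (ν 0) _) (n≤1+n _))) eq)
  tails : dec (ν ∘ suc) ≈[ suc (pos (ν ∘ suc) j) ] dec (μ ∘ suc)
  tails i i<p = begin
    dec (ν ∘ suc) i         ≡⟨ blocks-skip (ν 0) (ν ∘ suc) i ⟨
    dec ν (suc (ν 0 + i))   ≡⟨ eq _ (s<s (s<s (+-monoʳ-≤ (ν 0) (s≤s⁻¹ i<p)))) ⟩
    dec μ (suc (ν 0 + i))   ≡⟨ cong (λ k → dec μ (suc (k + i))) eq₀ ⟩
    dec μ (suc (μ 0 + i))   ≡⟨ blocks-skip (μ 0) (μ ∘ suc) i ⟩
    dec (μ ∘ suc) i         ∎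
    where open ≡-Reasoning

-- Sequences with a last one, and truncation

Last : (ℕ → Bool) → ℕ → Set
Last α n = α n ≡ true × (∀ i → n < i → α i ≡ false)

true≢false : ∀ {x} → x ≡ true → ¬ x ≡ false
true≢false refl ()

Last-≥ : ∀ {α m n} → Last α m → α n ≡ true → n ≤ m
Last-≥ (_ , zeros) αn = ≮⇒≥ λ m<n → true≢false αn (zeros _ m<n)

Last-unique : ∀ {α m n} → Last α m → Last α n → m ≡ n
Last-unique l l′ = ≤-antisym (Last-≥ l′ (proj₁ l)) (Last-≥ l (proj₁ l′))

-- Descends from the bound until a one is met; the one at `i` excludes the zero sequence.
bounded⇒Last : ∀ n {α} → (∀ i → n ≤ i → α i ≡ false) → ∀ i → α i ≡ true → ∃ (Last α)
bounded⇒Last zero    zeros i αi = contradiction (zeros i z≤n) (true≢false αi)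
bounded⇒Last (suc n) {α} zeros i αi with α n in αn
... | true  = n , αn , zeros
... | false = bounded⇒Last n zeros′ i αi
  where
  zeros′ : ∀ i → n ≤ i → α i ≡ false
  zeros′ i n≤i with m≤n⇒m<n∨m≡n n≤i
  ... | inj₁ n<i  = zeros i n<i
  ... | inj₂ refl = αn

-- Ones lie arbitrarily far out, because the `j`-th is at place `j` or later.
dec-¬Last : ∀ ν → ¬ ∃ (Last (dec ν))
dec-¬Last ν (n , l) = <⇒≱ (j≤pos ν (suc n)) (Last-≥ l (dec-pos ν (suc n)))

truncate : ℕ → (ℕ → Bool) → ℕ → Bool
truncate n α i with i <? n
... | yes _ = α i
... | no  _ = false

truncate-≈ : ∀ n α → truncate n α ≈[ n ] α
truncate-≈ n α i i<n with i <? n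
... | yes _   = refl
... | no  i≮n = contradiction i<n i≮n

truncate-zero : ∀ n α i → n ≤ i → truncate n α i ≡ false
truncate-zero n α i n≤i with i <? n
... | yes i<n = contradiction n≤i (<⇒≱ i<n)
... | no  _   = refl

truncate-Last : ∀ {n α} → α n ≡ true → Last (truncate (suc n) α) n
truncate-Last {n} {α} αn = trans (truncate-≈ (suc n) α n ≤-refl) αn , truncate-zero (suc n) α

prefix : (ℕ → ℕ) → ℕ → ℕ → Bool
prefix ν j = truncate (suc (pos ν j)) (dec ν)

prefix-Last : ∀ ν j → Last (prefix ν j) (pos ν j)
prefix-Last ν j = truncate-Last (dec-pos ν j)

-- Approximating prefixes by codes, and Baire category in ω^ω

replace : (ℕ → ℕ) → ℕ → ℕ → ℕ → ℕ
replace ν n v i with i <? n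
... | yes _ = ν i
... | no  _ = v

replace-≈ : ∀ ν n v → replace ν n v ≈[ n ] ν
replace-≈ ν n v i i<n with i <? n
... | yes _   = refl
... | no  i≮n = contradiction i<n i≮n

replace-at : ∀ ν n v → replace ν n v n ≡ v
replace-at ν n v with n <? n
... | yes n<n = contradiction n<n (n≮n n)
... | no  _   = refl

dec-next : ∀ ν j → dec ν (suc (pos ν j + ν (suc j))) ≡ true
dec-next ν j = trans (dec-drop ν j _)
  (subst (λ k → dec (ν ∘ (suc j +_)) (ν (suc k)) ≡ true) (+-identityʳ j)
    (blocks-one (ν (suc (j + 0))) (ν ∘ (suc j +_) ∘ suc)))

dec-gap : ∀ ν j i → i < ν (suc j) → dec ν (suc (pos ν j + i)) ≡ false
dec-gap ν j i i<ν = trans (dec-drop ν j i)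
  (blocks-zero _ _ i (subst (λ k → i < ν (suc k)) (sym (+-identityʳ j)) i<ν))

blocks-head : ∀ k ν μ → blocks k ν ≈[ suc k ] blocks k μ
blocks-head zero    ν μ zero    _         = refl
blocks-head zero    ν μ (suc i) (s<s ())
blocks-head (suc k) ν μ zero    _         = refl
blocks-head (suc k) ν μ (suc i) (s<s i<k) = blocks-head k ν μ i i<k

-- Sharper than `dec-cong`: the zeros counted by the common entries are settled too, not just one
-- place per entry.
dec-prefix : ∀ j {ν μ} → ν ≈[ suc j ] μ → dec ν ≈[ suc (pos ν j) ] dec μ
dec-prefix zero    {ν} {μ} eq rewrite eq 0 z<s = blocks-head (μ 0) (ν ∘ suc) (μ ∘ suc)
dec-prefix (suc j) {ν} {μ} eq i i<p rewrite eq 0 z<s with i <? suc (μ 0)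
... | yes i<μ = blocks-head (μ 0) (ν ∘ suc) (μ ∘ suc) i i<μ
... | no  i≮μ with i′ , refl ← m≤n⇒∃[o]m+o≡n (≮⇒≥ i≮μ) = begin
  blocks (μ 0) (ν ∘ suc) (suc (μ 0 + i′))   ≡⟨ blocks-skip (μ 0) (ν ∘ suc) i′ ⟩
  dec (ν ∘ suc) i′                          ≡⟨ dec-prefix j (λ k k<j → eq (suc k) (s<s k<j)) i′
    (s<s (+-cancelˡ-≤ (μ 0) _ _ (s≤s⁻¹ (s≤s⁻¹ i<p)))) ⟩
  dec (μ ∘ suc) i′                          ≡⟨ blocks-skip (μ 0) (μ ∘ suc) i′ ⟨
  blocks (μ 0) (μ ∘ suc) (suc (μ 0 + i′))   ∎
  where open ≡-Reasoning

-- Past the `j`-th one the prefix is zero, and `dec μ` is zero for `μ (suc j)` further places.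
prefix-near : ∀ ν j n μ → ν ≈[ suc j ] μ → n ≤ μ (suc j) →
              prefix ν j ≈[ suc (pos ν j) + n ] dec μ
prefix-near ν j n μ eq n≤μ i i<p with i <? suc (pos ν j)
... | yes i<pos = dec-prefix j eq i i<pos
... | no  i≮pos with i′ , refl ← m≤n⇒∃[o]m+o≡n (≮⇒≥ i≮pos) =
  sym (trans (cong (λ p → dec μ (suc (p + i′))) (pos-cong j eq))
             (dec-gap μ j i′ (<-≤-trans (+-cancelˡ-< (suc (pos ν j)) _ _ i<p) n≤μ)))

-- The source of all density arguments below: every ball of ω^ω contains a smaller ball whose codes
-- come as close as desired to a prefix of its centre.
near-prefix : ∀ ν j n → ∃ λ ν′ → ν ≈[ suc j ] ν′ ×
              (∀ μ → ν′ ≈[ suc (suc j) ] μ → prefix ν j ≈[ suc (pos ν j) + n ] dec μ)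
near-prefix ν j n = ν′ , ν≈ν′ , λ μ ν′≈μ →
  prefix-near ν j n μ (≈[]-trans (suc j) ν≈ν′ (≈[]-≤ (n≤1+n (suc j)) ν′≈μ))
    (≤-reflexive (trans (sym (replace-at ν (suc j) n)) (ν′≈μ (suc j) ≤-refl)))
  where
  ν′ : ℕ → ℕ
  ν′ = replace ν (suc j) n
  ν≈ν′ : ν ≈[ suc j ] ν′
  ν≈ν′ = ≈[]-sym (suc j) (replace-≈ ν (suc j) n)

-- The hypothesis says that each `O n` contains a dense open set; the point found is the limit of
-- the centres of nested balls.
baire-category : (O : ℕ → Pred (ℕ → ℕ) 0ℓ) →
        (∀ n ν k → ∃ λ ν′ → ∃ λ l → ν ≈[ k ] ν′ × (∀ μ → ν′ ≈[ l ] μ → μ ∈ O n)) →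
        ∃ λ μ → ∀ n → μ ∈ O n
baire-category O dense = μ , λ n → in-O n μ (limit (suc n))
  where
  Ball : Set
  Ball = (ℕ → ℕ) × ℕ
  shrink : ℕ → Ball → Ball
  -- Taking at least `suc k` makes the sizes grow without bound, so that the centres converge.
  shrink n (ν , k) = let ν′ , l , _ = dense n ν k in ν′ , suc k ⊔ l
  ball : ℕ → Ball
  ball zero    = const 0 , 0
  ball (suc n) = shrink n (ball n)
  centre : ℕ → ℕ → ℕ
  centre n = proj₁ (ball n)
  size : ℕ → ℕ
  size n = proj₂ (ball n)
  μ : ℕ → ℕ
  -- Place `i` is settled from ball `suc i` on, whose size exceeds `i`.
  μ i = centre (suc i) i
  in-O : ∀ n μ → centre (suc n) ≈[ size (suc n) ] μ → μ ∈ O n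
  in-O n μ eq = let ν , k = ball n ; _ , l , _ , ⊆O = dense n ν k in
    ⊆O μ (≈[]-≤ (m≤n⊔m (suc k) l) eq)
  size-< : ∀ n → size n < size (suc n)
  size-< n = let ν , k = ball n ; _ , l , _ = dense n ν k in m≤m⊔n (suc k) l
  n≤size : ∀ n → n ≤ size n
  n≤size zero    = z≤n
  n≤size (suc n) = ≤-<-trans (n≤size n) (size-< n)
  size-mono : ∀ d n → size n ≤ size (d + n)
  size-mono zero    n = ≤-refl
  size-mono (suc d) n = ≤-trans (size-mono d n) (<⇒≤ (size-< (d + n)))
  nested : ∀ d n → centre n ≈[ size n ] centre (d + n)
  nested zero    n i _   = refl
  nested (suc d) n i i<s = trans (nested d n i i<s)
    (let ν , k = ball (d + n) ; _ , _ , eq , _ = dense (d + n) ν k in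
     eq i (<-≤-trans i<s (size-mono d n)))
  limit : ∀ n → centre n ≈[ size n ] μ
  limit n i i<s with ≤-total n (suc i)
  ... | inj₁ n≤i = trans (nested (suc i ∸ n) n i i<s)
    (cong (λ m → centre m i) (m∸n+n≡m n≤i))
  ... | inj₂ i<n = sym (trans (nested (n ∸ suc i) (suc i) i (n≤size (suc i)))
    (cong (λ m → centre m i) (m∸n+n≡m i<n)))

-- The set of truncations of a sequence

Agrees : (ℕ → Bool) → (ℕ → Bool) → ℕ → Set
Agrees α x n = Last x n × x ≈[ suc n ] α

Truncation : (ℕ → Bool) → (ℕ → Bool) → Set
Truncation α x = ∃ (Agrees α x)

-- The last one of `x` is unique, so it is the only place at which `x` can have been cut.
Truncation-≈ : ∀ {α β x n} → Last x n → α ≈[ suc n ] β → Truncation α x → Truncation β x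
Truncation-≈ {n = n} l α≈β (m , l′ , x≈α) with refl ← Last-unique l l′ =
  n , l , ≈[]-trans (suc n) x≈α α≈β

Last-resp : ∀ {x y n} → (∀ i → x i ≡ y i) → Last x n → Last y n
Last-resp x≗y (xn , zeros) = trans (sym (x≗y _)) xn , λ i n<i → trans (sym (x≗y i)) (zeros i n<i)

Truncation-resp : ∀ {α x y} → (∀ i → x i ≡ y i) → Truncation α x → Truncation α y
Truncation-resp x≗y (n , l , x≈α) =
  n , Last-resp x≗y l , λ i i≤n → trans (sym (x≗y i)) (x≈α i i≤n)

self-Truncation : ∀ {α} → Truncation α α → ∃ (Last α)
self-Truncation (n , l , _) = n , l

prefix-Truncation : ∀ ν j μ → prefix ν j ≈[ suc (pos ν j) ] dec μ → Truncation (dec μ) (prefix ν j)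
prefix-Truncation ν j μ eq = pos ν j , prefix-Last ν j , eq

-- Closedness in the square of 2^ω, put in terms of approximating pairs so that it can be pulled
-- back along two continuous maps from any space.
LimitClosed : ((ℕ → Bool) → (ℕ → Bool) → Set) → Set
LimitClosed R = ∀ x α →
  (∀ n → ∃ λ y → ∃ λ β → x ≈[ n ] y × α ≈[ n ] β × R y β) → R x α

module _ (em : ∀ {ℓ} → ExcludedMiddle ℓ) where

  dne : {P : Set a} → ¬ ¬ P → P
  dne {P = P} ¬¬p with em {P = P}
  ... | yes p = p
  ... | no ¬p = contradiction ¬p ¬¬p

  ¬∀⇒∃¬ : {B : Set a} {P : B → Set b} → ¬ (∀ x → P x) → ∃ λ x → ¬ P x
  ¬∀⇒∃¬ ¬all = dne λ none → ¬all λ x → dne λ ¬Px → none (x , ¬Px)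

  -- The points visited from a point outside `D`

  module _ (X : Space 0ℓ o) (W : ℕ → Pred (Carrier X) 0ℓ) (D : ℕ → Carrier X) where

    open Space X using (_≈_)
    open VecMembership (Space.setoid X) using () renaming (_∈_ to _∈ᵛ_; _∉_ to _∉ᵛ_)

    next-≡ : ∀ x {n} (h : Vec (Carrier X) (suc n)) → ¬ x ≈ head h →
             ∃ (Least (Candidate em X W D x h)) →
             ∃ λ p → Least (Candidate em X W D x h) p × next em X W D x h ≡ D p
    next-≡ x h x≉ ex with em {P = x ≈ head h}
    ... | yes x≈ = contradiction x≈ x≉
    ... | no  _ with em {P = ∃ (Least (Candidate em X W D x h))}
    ...   | yes (p , least-p) = p , least-p , refl
    ...   | no  none          = contradiction ex none

    -- The invariant of the recovery process: `p` is the index of the current point, bounds the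
    -- indices of all points visited so far, and lies below every remaining candidate.
    record Stage (x : Carrier X) (t p : ℕ) : Set where
      field
        current : s[_] em X W D x t ≡ D p
        late    : t ≤ p
        earlier : ∀ {y} → y ∈ᵛ history em X W D x t → ∃ λ j → j ≤ p × y ≈ D j
        later   : ∀ q → Candidate em X W D x (history em X W D x t) q → p < q

    open Stage

    module _ (t₁ : T₁ X) (gb : IsGoodBasis X W) (dense : Dense X D)
             (x : Carrier X) (x∉D : ∀ j → ¬ x ≈ D j) where

      private
        h : ∀ t → Vec (Carrier X) (suc t)
        h = history em X W D x

      stage-zero : Stage x 0 0
      stage-zero = record
        { current = refl
        ; late    = z≤n
        ; earlier = λ { (here y≈) → 0 , z≤n , y≈ }
        ; later   = λ { zero (_ , _ , D∈W , W⊆) → contradiction (here (Space.refl X)) (W⊆ D∈W)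
                      ; (suc q) _ → z<s }
        }

      stage-suc : ∀ {t p} → Stage x t p →
                  ∃ λ p′ → Stage x (suc t) p′ × Least (Candidate em X W D x (h t)) p′
      stage-suc {t} {p} st =
        p′ , record
          { current = next≡
          ; late    = ≤-<-trans (late st) p<p′
          ; earlier = λ { (here y≈)  → p′ , ≤-refl , subst (_ ≈_) next≡ y≈
                        ; (there y∈) → let j , j≤p , y≈ = earlier st y∈ in
                                       j , ≤-trans j≤p (<⇒≤ p<p′) , y≈ }
          -- A candidate for the longer history was one for the shorter, so it is not below `p′`;
          -- nor is it `p′`, whose point has now been visited.
          ; later   = λ q (m , x∈W , Dq∈W , W⊆) →
              ≤∧≢⇒<
                (≮⇒≥ λ q<p′ → proj₂ least-p′ q q<p′ (m , x∈W , Dq∈W , λ y∈W y∈h → W⊆ y∈W (there y∈h)))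
                λ { refl → W⊆ Dq∈W (here (Space.reflexive X (sym next≡))) }
          } , least-p′
        where
        x≉ : ¬ x ≈ s[_] em X W D x t
        x≉ = subst (λ y → ¬ x ≈ y) (sym (current st)) (x∉D p)
        found = next-≡ x (h t) x≉
          (next-defined em X W D x t₁ gb dense (h t) (unvisited em X W D x t x≉))
        p′ : ℕ
        p′ = proj₁ found
        least-p′ : Least (Candidate em X W D x (h t)) p′
        least-p′ = proj₁ (proj₂ found)
        next≡ : next em X W D x (h t) ≡ D p′
        next≡ = proj₂ (proj₂ found)
        p<p′ : p < p′
        p<p′ = later st p′ (proj₁ least-p′)

      stage : ∀ t → ∃ (Stage x t)
      stage zero    = 0 , stage-zero
      stage (suc t) = let p′ , st , _ = stage-suc (proj₂ (stage t)) in p′ , st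

      -- The indices of s_t, s_{t+1}, … increase, and they cannot jump over q,
      -- which remains a candidate as long as they stay below it.
      visits : ∀ {t p q m} → Stage x t p → p < q → x ∈ W m → D q ∈ W m →
               (∀ j → j < q → ∀ y → y ≈ D j → ¬ y ∈ W m) →
               ∃ λ t′ → t < t′ × s[_] em X W D x t′ ≡ D q
      visits {t} {p} {q} {m} st p<q x∈W Dq∈W avoids =
        go (q ∸ p) st p<q (≤-reflexive (sym (m+[n∸m]≡n (<⇒≤ p<q))))
        where
        -- `d` bounds the distance from the current index to `q`; the index grows at every stage.
        go : ∀ d {t p} → Stage x t p → p < q → q ≤ p + d → ∃ λ t′ → t < t′ × s[_] em X W D x t′ ≡ D q
        go zero    {p = p} st p<q q≤p = contradiction (subst (q ≤_) (+-identityʳ p) q≤p) (<⇒≱ p<q)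
        go (suc d) {t} {p} st p<q q≤p+d with stage-suc st
        ... | p′ , st′ , (cand , least-p′) with <-cmp p′ q
        ...   | tri≈ _ refl _ = suc t , ≤-refl , current st′
        ...   | tri> _ _ q<p′ = contradiction
          (m , x∈W , Dq∈W , λ {y} y∈W y∈h → let j , j≤p , y≈ = earlier st y∈h in
            avoids j (≤-<-trans j≤p p<q) y y≈ y∈W)
          (least-p′ q q<p′)
        ...   | tri< p′<q _ _ =
          let t′ , t<t′ , eq = go d st′ p′<q (≤-trans (subst (q ≤_) (+-suc p d) q≤p+d)
                                              (+-monoˡ-≤ d (later st p′ cand)))
          in t′ , <⇒≤ t<t′ , eq

  -- Indicator functions of the sets of truncations

  ind : Set → Bool
  ind P = does (em {P = P})

  ind-true : ∀ {P} → P → ind P ≡ true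
  ind-true {P} p with em {P = P}
  ... | yes _ = refl
  ... | no ¬p = contradiction p ¬p

  ind-false : ∀ {P} → ¬ P → ind P ≡ false
  ind-false {P} ¬p with em {P = P}
  ... | yes p = contradiction p ¬p
  ... | no  _ = refl

  ind-true⁻ : ∀ {P} → ind P ≡ true → P
  ind-true⁻ eq = dne λ ¬p → true≢false eq (ind-false ¬p)

  ind-false⁻ : ∀ {P} → ind P ≡ false → ¬ P
  ind-false⁻ eq p = true≢false (ind-true p) eq

  ind-cong : ∀ {P Q} → (P → Q) → (Q → P) → ind P ≡ ind Q
  ind-cong {P} {Q} f g with em {P = Q}
  ... | yes q = ind-true (g q)
  ... | no ¬q = ind-false (¬q ∘ f)

  fun : (ℕ → Bool) → (ℕ → Bool) → Bool
  fun α x = ind (Truncation α x)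

  fun-resp : ∀ α {x y} → (∀ i → x i ≡ y i) → fun α x ≡ fun α y
  fun-resp α eq = ind-cong (Truncation-resp eq) (Truncation-resp (λ i → sym (eq i)))

  -- If `x` has a last one, only the part of `α` up to it matters; otherwise the value is `false`
  -- for every `α`. This gives continuity into the topology of pointwise convergence.
  fun-locally-constant : ∀ x → ∃ λ n → ∀ α β → α ≈[ n ] β → fun α x ≡ fun β x
  fun-locally-constant x with em {P = ∃ (Last x)}
  ... | yes (n , l) = suc n , λ α β eq →
    ind-cong (Truncation-≈ l eq) (Truncation-≈ l (≈[]-sym (suc n) eq))
  ... | no none = 0 , λ α β _ →
    ind-cong (λ (n , l , _) → contradiction (n , l) none) (λ (n , l , _) → contradiction (n , l) none)

  -- Evaluation at a truncation of `α` tests whether `β` has the same initial segment.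
  fun-truncate : ∀ α β n → α n ≡ true →
                 fun α (truncate (suc n) α) ≡ fun β (truncate (suc n) α) → α ≈[ suc n ] β
  fun-truncate α β n αn eq
    with k , l , eq′ ← ind-true⁻ (trans (sym eq)
           (ind-true (n , truncate-Last αn , truncate-≈ (suc n) α)))
    with refl ← Last-unique (truncate-Last αn) l =
    ≈[]-trans (suc n) (≈[]-sym (suc n) (truncate-≈ (suc n) α)) eq′

  -- Where two sequences differ, one of them has a one, and its truncation there separates the two
  -- functions.
  fun-injective : ∀ {α β} → (∀ x → fun α x ≡ fun β x) → ∀ n → α n ≡ β n
  fun-injective {α} {β} eq n with α n in αn | β n in βn
  ... | true  | true  = refl
  ... | false | false = refl
  ... | true  | false = trans (sym αn) (trans (fun-truncate α β n αn (eq _) n ≤-refl) βn)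
  ... | false | true  = trans (sym αn) (trans (sym (fun-truncate β α n βn (sym (eq _)) n ≤-refl)) βn)

  -- Evaluation along continuous maps is Baire class one

  module _ (Z : Space c o) (x a : Carrier Z → ℕ → Bool)
           (x-cont : Continuous Z Cantor x) (a-cont : Continuous Z Cantor a) where

    LimitClosed⇒Closed : ∀ {R} → LimitClosed R → Closed Z (λ z → R (x z) (a z))
    LimitClosed⇒Closed {R} closed = Space.open-local Z nbhd
      where
      nbhd : ∀ z → ¬ R (x z) (a z) → ∃ λ V → Open Z V × z ∈ V × V ⊆ (λ z → ¬ R (x z) (a z))
      nbhd z ¬R with em {P = ∃ λ n → ∀ y β → x z ≈[ n ] y → a z ≈[ n ] β → ¬ R y β}
      ... | yes (n , none) =
        _ , Space.open-∩ Z (x-cont _ (Open-ball (x z) n)) (a-cont _ (Open-ball (a z) n)) ,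
        ((λ _ _ → refl) , (λ _ _ → refl)) , λ (x≈ , a≈) → none _ _ x≈ a≈
      ... | no far = contradiction (closed (x z) (a z) λ n → dne λ none →
        far (n , λ y β x≈ a≈ Ryβ → none (y , β , x≈ , a≈ , Ryβ))) ¬R

    -- On the closed set x z ≗ a z, membership means that a z has a last one. If
    -- this does not depend on z, it is the constant proposition ¬ P.
    fun-BaireOne : (P : Set) → (∀ z → P → ¬ ∃ (Last (a z))) → (∀ z → ¬ ∃ (Last (a z)) → P) →
                   BaireOne Z Two (λ z → fun (a z) (x z))
    fun-BaireOne P P⇒ ⇒P V _ = preimage (em {P = V true}) (em {P = V false})
      where
      T : ℕ → (ℕ → Bool) → (ℕ → Bool) → Set
      T n x α = Agrees α x n

      -- Three ways for `x` not to be a truncation of `α`: it is zero; it equals `α`, which has no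
      -- last one; or it has a one at `k` and differs from `α` at `k` or before, hence also before
      -- any cut.
      F : ℕ → (ℕ → Bool) → (ℕ → Bool) → Set
      F zero          x α = ∀ i → x i ≡ false
      F (suc zero)    x α = P × (∀ i → x i ≡ α i)
      F (suc (suc k)) x α = x k ≡ true × ¬ x ≈[ suc k ] α

      T-closed : ∀ n → LimitClosed (T n)
      T-closed n x α near =
        ( (let y , β , x≈ , _ , (yn , _) , _ = near (suc n) in trans (x≈ n ≤-refl) yn)
        , (λ i n<i → let y , β , x≈ , _ , (_ , zeros) , _ = near (suc i) in trans (x≈ i ≤-refl) (zeros i n<i)) )
        , (let y , β , x≈ , α≈ , _ , eq = near (suc n) in
           ≈[]-trans (suc n) x≈ (≈[]-trans (suc n) eq (≈[]-sym (suc n) α≈)))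

      F-closed : ∀ n → LimitClosed (F n)
      F-closed zero x α near i =
        let y , β , x≈ , _ , zeros = near (suc i) in trans (x≈ i ≤-refl) (zeros i)
      F-closed (suc zero) x α near =
        (let y , β , _ , _ , p , _ = near 0 in p) ,
        λ i → let y , β , x≈ , α≈ , _ , eq = near (suc i) in
              trans (x≈ i ≤-refl) (trans (eq i) (sym (α≈ i ≤-refl)))
      F-closed (suc (suc k)) x α near =
        let y , β , x≈ , α≈ , yk , y≉β = near (suc k) in
        trans (x≈ k ≤-refl) yk ,
        λ x≈α → y≉β (≈[]-trans (suc k) (≈[]-sym (suc k) x≈) (≈[]-trans (suc k) x≈α α≈))

      F-sound : ∀ n z → F n (x z) (a z) → ¬ Truncation (a z) (x z)
      F-sound zero z zeros (n , (xn , _) , _) = true≢false xn (zeros n)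
      F-sound (suc zero) z (p , x≗a) (n , (xn , zeros) , _) =
        P⇒ z p (n , trans (sym (x≗a n)) xn , λ i n<i → trans (sym (x≗a i)) (zeros i n<i))
      F-sound (suc (suc k)) z (xk , x≉a) (n , l , x≈a) = x≉a (≈[]-≤ (s≤s (Last-≥ l xk)) x≈a)

      F-complete : ∀ z → ¬ Truncation (a z) (x z) → ∃ λ n → F n (x z) (a z)
      F-complete z ∉ with em {P = ∃ λ i → x z i ≡ true}
      ... | no none = 0 , λ i → ¬-not λ xi → none (i , xi)
      ... | yes (i , xi) with em {P = ∃ (Last (x z))}
      ...   | yes (k , l) = suc (suc k) , proj₁ l , λ x≈a → ∉ (k , l , x≈a)
      ...   | no noLast with em {P = ∀ i → x z i ≡ a z i}
      ...     | yes x≗a = 1 , ⇒P z (λ (n , an , zeros) → noLast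
        (n , trans (x≗a n) an , λ i n<i → trans (x≗a i) (zeros i n<i))) , x≗a
      ...     | no x≭a =
        -- Here `x` has infinitely many ones, so one of them lies at or past the place of
        -- difference.
        let n , xn≢an = ¬∀⇒∃¬ x≭a
            j , n≤j , xj = unbounded n
        in suc (suc j) , xj , λ x≈a → xn≢an (x≈a n (s≤s n≤j))
        where
        unbounded : ∀ n → ∃ λ j → n ≤ j × x z j ≡ true
        unbounded n = dne λ none → noLast (bounded⇒Last n
          (λ j n≤j → ¬-not λ xj → none (j , n≤j , xj)) i xi)

      Fσ : (R : ℕ → (ℕ → Bool) → (ℕ → Bool) → Set) → (∀ n → LimitClosed (R n)) →
           (∀ n z → R n (x z) (a z) → V (fun (a z) (x z))) →
           (∀ z → V (fun (a z) (x z)) → ∃ λ n → R n (x z) (a z)) →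
           IsFσ Z ((λ z → fun (a z) (x z)) ⊢ V)
      Fσ R R-closed sound complete =
        (λ n z → R n (x z) (a z)) , (λ n → LimitClosed⇒Closed (R-closed n)) ,
        (λ {z} → complete z) , λ {z} (n , r) → sound n z r

      preimage : Dec (V true) → Dec (V false) → IsFσ Z ((λ z → fun (a z) (x z)) ⊢ V)
      preimage (yes vt) (yes vf) = Fσ (λ _ _ _ → ⊤) (λ _ _ _ _ → tt)
        (λ n z _ → both (fun (a z) (x z))) (λ _ _ → 0 , tt)
        where
        both : ∀ b → V b
        both true  = vt
        both false = vf
      preimage (yes vt) (no ¬vf) = Fσ T T-closed
        (λ n z t → subst V (sym (ind-true (n , t))) vt)
        (λ z v → dne λ none → ¬vf (subst V (ind-false none) v))
      preimage (no ¬vt) (yes vf) = Fσ F F-closed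
        (λ n z t → subst V (sym (ind-false (F-sound n z t))) vf)
        (λ z v → F-complete z λ t → ¬vt (subst V (ind-true t) v))
      preimage (no ¬vt) (no ¬vf) = Fσ (λ _ _ _ → ⊥) (λ _ _ _ near → proj₂ (proj₂ (proj₂ (proj₂ (near 0)))))
        (λ _ _ ()) (λ z v → contradiction v (neither (fun (a z) (x z))))
        where
        neither : ∀ b → ¬ V b
        neither true  = ¬vt
        neither false = ¬vf

  -- The continuous injection into the Baire class one functions

  const-continuous : (Z : Space c o) (α : ℕ → Bool) → Continuous Z Cantor (const α)
  const-continuous Z α V _ = Space.open-local Z λ z α∈V →
    (λ _ → ⊤) , Space.open-U Z , tt , λ _ → α∈V

  B₁ : Space _ _
  B₁ = 𝓑₁ Cantor Two

  -- With a constant second map, having no last one is a fixed proposition, as `fun-BaireOne`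
  -- demands.
  fun₁ : (ℕ → Bool) → Carrier B₁
  fun₁ α = record { to = fun α ; cong = fun-resp α } ,
    fun-BaireOne Cantor id (const α) (λ _ → id) (const-continuous Cantor α)
      (¬ ∃ (Last α)) (λ _ → id) (λ _ → id)

  fun₁-cong : ∀ {α β} → (∀ i → α i ≡ β i) → Space._≈_ B₁ (fun₁ α) (fun₁ β)
  fun₁-cong eq x = let n , const = fun-locally-constant x in const _ _ λ i _ → eq i

  fun₁-continuous : Continuous Cantor B₁ fun₁
  fun₁-continuous = subbase-continuous Cantor fun₁ λ (V , V-open) →
    subbase-continuous Cantor (proj₁ ∘ fun₁)
      (λ (x , V , _) → cylinders⇒Open λ α α∈ →
        let n , const = fun-locally-constant x in
        n , λ β α≈β → subst V (const α β α≈β) α∈)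
      V V-open

  I : Injection (Space.setoid Cantor) (Space.setoid B₁)
  I = record { to = fun₁ ; cong = fun₁-cong ; injective = fun-injective }

  -- Failure of uniform recoverability

  avoiding-ball : ∀ (D : ℕ → ℕ → Bool) x n → (∀ j → j < n → ¬ (∀ i → x i ≡ D j i)) →
                  ∃ λ l → ∀ j → j < n → ∀ y → (∀ i → y i ≡ D j i) → ¬ x ≈[ l ] y
  avoiding-ball D x zero    x∉D = 0 , λ _ ()
  avoiding-ball D x (suc n) x∉D =
    let l , avoid = avoiding-ball D x n (λ j j<n → x∉D j (m<n⇒m<1+n j<n))
        i , xi≢   = ¬∀⇒∃¬ (x∉D n ≤-refl)
    in suc i ⊔ l , λ j j<1+n y y≗D x≈y → [ (λ j<n → avoid j j<n y y≗D (≈[]-≤ (m≤n⊔m (suc i) l) x≈y))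
                                         , (λ { refl → xi≢ (trans (x≈y i (m≤m⊔n (suc i) l)) (y≗D i)) }) ]′
                                         (m<1+n⇒m<n∨m≡n j<1+n)

  -- Used to force the index of a prefix to be large: a last one beyond `M` cannot belong to any of
  -- the first `n` points.
  Last-bound : ∀ (D : ℕ → ℕ → Bool) n → ∃ λ M → ∀ j → j < n → ∀ k → Last (D j) k → k < M
  Last-bound D zero    = 0 , λ _ ()
  Last-bound D (suc n) with M , bound ← Last-bound D n with em {P = ∃ (Last (D n))}
  ... | yes (k , l) = suc k ⊔ M , λ j j<1+n k′ l′ →
    [ (λ j<n → <-≤-trans (bound j j<n k′ l′) (m≤n⊔m (suc k) M))
    , (λ { refl → <-≤-trans (s≤s (≤-reflexive (Last-unique l′ l))) (m≤m⊔n (suc k) M) })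
    ]′ (m<1+n⇒m<n∨m≡n j<1+n)
  ... | no none = M , λ j j<1+n k l →
    [ (λ j<n → bound j j<n k l) , (λ { refl → contradiction (k , l) none }) ]′ (m<1+n⇒m<n∨m≡n j<1+n)

  -- Stated for any `A` containing the functions of all codes, so that it covers both the image of
  -- `I` and `Codes`.
  module _ (W : ℕ → Pred (ℕ → Bool) 0ℓ) (gb : IsGoodBasis Cantor W)
           (A : Pred (Carrier B₁) a) (fun∈A : ∀ ν → fun₁ (dec ν) ∈ A) where

    open IsGoodBasis gb

    module _ (D : ℕ → ℕ → Bool) (dense : Dense Cantor D)
             (rec : ∀ f → f ∈ A → Recoverable em Cantor Two W D (Func.to (proj₁ f))) where

      open Stage

      -- Convergence in a discrete space is eventual constancy.
      recovers-from : ∀ x ν → ∃ λ N → ∀ t → N ≤ t → fun (dec ν) (s[_] em Cantor W D x t) ≡ fun (dec ν) x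
      recovers-from x ν = rec (fun₁ (dec ν)) (fun∈A ν) x (_≡ fun (dec ν) x) tt refl

      -- If a prefix q were not listed in D, two sequences extending q and
      -- separated right after it would force s_t[q,D] into {q} eventually.
      prefix∈D : ∀ ν j → ∃ λ p → ∀ i → prefix ν j i ≡ D p i
      prefix∈D ν j = dne λ q∉ → contradiction-from λ p eq → q∉ (p , eq)
        where
        q : ℕ → Bool
        q = prefix ν j
        k : ℕ
        k = pos ν j
        -- Both branches extend `q` up to place `k`; at `suc k`, branch 0 has a one and branch 1 a
        -- zero.
        branch : ℕ → ℕ → ℕ
        branch = replace ν (suc j)
        q≈branch : ∀ v → q ≈[ suc k ] dec (branch v)
        q≈branch v = ≈[]-≤ (m≤m+n (suc k) 0)
          (prefix-near ν j 0 (branch v) (≈[]-sym (suc j) (replace-≈ ν (suc j) v)) z≤n)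
        branch-next : ∀ v → suc (pos (branch v) j) ≡ suc k
        branch-next v = cong suc (pos-cong j (replace-≈ ν (suc j) v))
        branch₀ : dec (branch 0) (suc k) ≡ true
        branch₀ = subst (λ n → dec (branch 0) n ≡ true)
          (trans (cong (λ v → suc (pos (branch 0) j + v)) (replace-at ν (suc j) 0))
                 (trans (cong suc (+-identityʳ _)) (branch-next 0)))
          (dec-next (branch 0) j)
        branch₁ : dec (branch 1) (suc k) ≡ false
        branch₁ = subst (λ n → dec (branch 1) n ≡ false)
          (trans (cong suc (+-identityʳ _)) (branch-next 1))
          (dec-gap (branch 1) j 0 (≤-reflexive (sym (replace-at ν (suc j) 1))))
        -- The last one of `y` is not before `k`, where `q` has a one, and not after it, where `y`
        -- would follow both branches; so it is at `k`.
        separated : ∀ {y} → q ≈[ suc k ] y → Truncation (dec (branch 0)) y →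
                    Truncation (dec (branch 1)) y → ∀ i → q i ≡ y i
        separated {y} q≈y (n , l , y≈₀) (n′ , l′ , y≈₁) i with refl ← Last-unique l l′ with <-cmp n k
        ... | tri< n<k _ _ = contradiction
          (Last-≥ l (trans (sym (q≈y k ≤-refl)) (proj₁ (prefix-Last ν j)))) (<⇒≱ n<k)
        ... | tri> _ _ k<n = contradiction
          (trans (sym (y≈₁ (suc k) (s≤s k<n))) (trans (y≈₀ (suc k) (s≤s k<n)) branch₀))
          (λ eq → true≢false eq branch₁)
        ... | tri≈ _ refl _ with <-≤-connex i (suc n)
        ...   | inj₁ i≤n = q≈y i i≤n
        ...   | inj₂ n<i = trans (proj₂ (prefix-Last ν j) i n<i) (sym (proj₂ l i n<i))
        contradiction-from : (∀ p → ¬ (∀ i → q i ≡ D p i)) → ⊥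
        contradiction-from q∉D
          with N₀ , tail₀ ← recovers-from q (branch 0)
             | N₁ , tail₁ ← recovers-from q (branch 1)
          with p , st ← stage Cantor W D (^ω-T₁ em Bool) gb dense q q∉D (N₀ ⊔ N₁)
          -- The ball omits `D 0` to `D p`, so the first point listed in `W m` has index above `p`
          -- and is visited after both tails have begun.
          with l , avoid ← avoiding-ball D q (suc p) (λ j _ → q∉D j)
          with m , q∈W , W⊆ball ← W-basis _ (Open-ball q (suc k ⊔ l)) q (λ _ _ → refl)
          with r , Dr∈W , Dr-least ← least em Cantor W D q (λ r → D r ∈ W m) (dense (W m) (W-open m) (q , q∈W))
          with t , N<t , s≡Dr ← visits Cantor W D (^ω-T₁ em Bool) gb dense q q∉D st
                 (≰⇒> λ r≤p → avoid r (s≤s r≤p) (D r) (λ _ → refl) (≈[]-≤ (m≤n⊔m (suc k) l) (W⊆ball Dr∈W)))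
                 q∈W Dr∈W
                 (λ j j<r y y≗Dj y∈W → Dr-least j j<r (Space.open-resp Cantor (W-open m) y≗Dj y∈W))
          = q∉D r (separated (≈[]-≤ (m≤m⊔n (suc k) l) (W⊆ball Dr∈W))
                     (in-branch 0 (tail₀ t (≤-trans (m≤m⊔n N₀ N₁) (<⇒≤ N<t))))
                     (in-branch 1 (tail₁ t (≤-trans (m≤n⊔m N₀ N₁) (<⇒≤ N<t)))))
          where
          in-branch : ∀ v → fun (dec (branch v)) (s[_] em Cantor W D q t) ≡ fun (dec (branch v)) q →
                      Truncation (dec (branch v)) (D r)
          in-branch v eq = ind-true⁻ (trans (cong (fun (dec (branch v))) (sym s≡Dr))
            (trans eq (ind-true (k , prefix-Last ν j , q≈branch v))))

      -- Given μ in every Visit n, s_t[dec μ,D] is infinitely often a prefix of dec μ.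
      Visit : ℕ → Pred (ℕ → ℕ) 0ℓ
      Visit n μ = ∃ λ p → n ≤ p × Truncation (dec μ) (D p) ×
        ∃ λ m → dec μ ∈ W m × D p ∈ W m × (∀ j → j < p → ∀ y → (∀ i → y i ≡ D j i) → ¬ y ∈ W m)

      -- As `p` is the first index of the prefix, some basic neighbourhood of it misses all earlier
      -- points, and all codes near the prefix lie in it.
      Visit-near : ∀ ν j p → Least (λ p → ∀ i → prefix ν j i ≡ D p i) p →
                   ∃ λ ν′ → ν ≈[ suc j ] ν′ × (∀ μ → ν′ ≈[ suc (suc j) ] μ → μ ∈ Visit p)
      Visit-near ν j p (q≗Dp , p-least)
        with l , avoid ← avoiding-ball D (prefix ν j) p p-least
        with m , q∈W , W⊆ball ← W-basis _ (Open-ball (prefix ν j) l) (prefix ν j) (λ _ _ → refl)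
        with L , ball⊆W ← Open⇒cylinder (W-open m) (prefix ν j) q∈W
        with ν′ , ν≈ν′ , near ← near-prefix ν j L
        = ν′ , ν≈ν′ , λ μ ν′≈μ →
          p , ≤-refl ,
          Truncation-resp q≗Dp (prefix-Truncation ν j μ (≈[]-≤ (m≤m+n (suc (pos ν j)) L) (near μ ν′≈μ))) ,
          m , ball⊆W (dec μ) (≈[]-≤ (m≤n+m L (suc (pos ν j))) (near μ ν′≈μ)) ,
          Space.open-resp Cantor (W-open m) q≗Dp q∈W ,
          λ i i<p y y≗Di y∈W → avoid i i<p y y≗Di (W⊆ball y∈W)

      Visit-dense : ∀ n ν k → ∃ λ ν′ → ∃ λ l → ν ≈[ k ] ν′ × (∀ μ → ν′ ≈[ l ] μ → μ ∈ Visit n)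
      Visit-dense n ν k with M , bound ← Last-bound D n =
        shrink (least em Cantor W D (λ _ → false) _ (prefix∈D ν j))
        where
        j : ℕ
        -- `k` preserves the first `k` entries of `ν`; `M` puts the last one of the prefix beyond
        -- those of `D p` for all `p < n`.
        j = k ⊔ M
        shrink : ∃ (Least (λ p → ∀ i → prefix ν j i ≡ D p i)) →
                 ∃ λ ν′ → ∃ λ l → ν ≈[ k ] ν′ × (∀ μ → ν′ ≈[ l ] μ → μ ∈ Visit n)
        shrink (p , least-p) with ν′ , ν≈ν′ , ⊆Visit ← Visit-near ν j p least-p =
          ν′ , suc (suc j) , ≈[]-≤ (m≤n⇒m≤1+n (m≤m⊔n k M)) ν≈ν′ , λ μ ν′≈μ →
          let r , p≤r , visit = ⊆Visit μ ν′≈μ in r , ≤-trans n≤p p≤r , visit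
          where
          n≤p : n ≤ p
          n≤p = ≮⇒≥ λ p<n → <⇒≱ (bound p p<n (pos ν j) (Last-resp (proj₁ least-p) (prefix-Last ν j)))
                                (≤-trans (m≤n⊔m k M) (j≤pos ν j))

      -- `fun (dec μ)` is 1 at the visited prefixes but 0 at `dec μ`, which has no last one.
      Visit-contradiction : ∀ μ → ¬ (∀ n → μ ∈ Visit n)
      Visit-contradiction μ visit = from (recovers-from (dec μ) μ)
        where
        x∉D : ∀ j → ¬ (∀ i → dec μ i ≡ D j i)
        -- Some `W m` contains `dec μ` but misses `D j`.
        x∉D j x≗Dj = let p , j<p , _ , m , x∈W , _ , avoid = visit (suc j) in
                     avoid j j<p (dec μ) x≗Dj x∈W
        from : ¬ ∃ λ N → ∀ t → N ≤ t → fun (dec μ) (s[_] em Cantor W D (dec μ) t) ≡ fun (dec μ) (dec μ)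
        from (N , tail)
          with p , st ← stage Cantor W D (^ω-T₁ em Bool) gb dense (dec μ) x∉D N
          with r , p<r , Dr-trunc , m , x∈W , Dr∈W , avoid ← visit (suc p)
          with t , N<t , s≡Dr ← visits Cantor W D (^ω-T₁ em Bool) gb dense (dec μ) x∉D st p<r x∈W Dr∈W avoid
          = true≢false (trans (cong (fun (dec μ)) s≡Dr) (ind-true Dr-trunc))
              (trans (tail t (<⇒≤ N<t)) (ind-false (dec-¬Last μ ∘ self-Truncation)))

    not-uniformly-recoverable : ¬ UniformlyRecoverable em Cantor Two W A
    not-uniformly-recoverable (D , dense , rec) =
      let μ , visit = baire-category (Visit D dense rec) (Visit-dense D dense rec)
      in Visit-contradiction D dense rec μ visit

  -- Evaluation on the diagonal

  diagonal : (α : ℕ → Bool) → Carrier (Cantor ×ᵗ Subspace B₁ (Image Cantor B₁ I))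
  diagonal α = α , fun₁ α , α , λ _ → refl

  diagonal-continuous : Continuous Cantor (Cantor ×ᵗ Subspace B₁ (Image Cantor B₁ I)) diagonal
  diagonal-continuous = subbase-continuous Cantor diagonal λ
    { (inj₁ (V , V-open)) → V-open
    ; (inj₂ (V , V-open)) → subbase-continuous Cantor (proj₂ ∘ diagonal)
        (λ (V , V-open) → fun₁-continuous V V-open) V V-open }

  -- Otherwise closed sets `F n` would cover all codes on the diagonal and contain no prefix. As
  -- prefixes are approximated by codes, the codes avoiding `F n` contain a dense open set, and by
  -- Baire category some code avoids every `F n`.
  evaluation-not-BaireOne :
    ¬ BaireOne (Cantor ×ᵗ Subspace B₁ (Image Cantor B₁ I)) Two (evaluation Cantor Two (Image Cantor B₁ I))
  evaluation-not-BaireOne baireOne with F , F-closed , (⊆F , F⊆) ← baireOne (_≡ false) tt =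
    let μ , ∉F = baire-category Avoids Avoids-dense
        n , ∈F = ⊆F {diagonal (dec μ)} (ind-false (dec-¬Last μ ∘ self-Truncation))
    in ∉F n ∈F
    where
    Avoids : ℕ → Pred (ℕ → ℕ) 0ℓ
    Avoids n μ = ¬ F n (diagonal (dec μ))
    prefix∉F : ∀ n ν j → ¬ F n (diagonal (prefix ν j))
    prefix∉F n ν j q∈F = ind-false⁻ (F⊆ {diagonal (prefix ν j)} (n , q∈F))
      (pos ν j , prefix-Last ν j , λ _ _ → refl)
    Avoids-dense : ∀ n ν k → ∃ λ ν′ → ∃ λ l → ν ≈[ k ] ν′ × (∀ μ → ν′ ≈[ l ] μ → μ ∈ Avoids n)
    Avoids-dense n ν k =
      let L , ball⊆ = Open⇒cylinder (diagonal-continuous (∁ (F n)) (F-closed n)) (prefix ν k) (prefix∉F n ν k)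
          ν′ , ν≈ν′ , near = near-prefix ν k L
      in ν′ , suc (suc k) , ≈[]-≤ (n≤1+n k) ν≈ν′ , λ μ ν′≈μ →
         ball⊆ (dec μ) (≈[]-≤ (m≤n+m L (suc (pos ν k))) (near μ ν′≈μ))

  -- The copy of ω^ω and its evaluation map

  Codes : Pred (Carrier B₁) 0ℓ
  Codes f = ∃ λ ν → Space._≈_ B₁ (fun₁ (dec ν)) f

  -- Membership in `Codes` carries the sequence, so decoding is a projection; `code-≈` makes it
  -- respect equality of functions.
  code : Carrier (Subspace B₁ Codes) → ℕ → ℕ
  code (_ , ν , _) = ν

  -- The value at one point settles `suc n` entries of the code, so a single subbasic set serves as
  -- neighbourhood in `code-continuous`.
  code-≈ : ∀ n {f g} →
           Func.to (proj₁ (proj₁ f)) (prefix (code f) n) ≡ Func.to (proj₁ (proj₁ g)) (prefix (code f) n) →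
           code f ≈[ suc n ] code g
  code-≈ n {_ , ν , ≈f} {_ , μ , ≈g} eq = dec-injective n
    (fun-truncate (dec ν) (dec μ) (pos ν n) (dec-pos ν n) (trans (≈f _) (trans eq (sym (≈g _)))))

  code-continuous : Continuous (Subspace B₁ Codes) (ℕ ^ω) code
  code-continuous = subbase-continuous (Subspace B₁ Codes) code λ (n , V , _) f f∈ →
    (Nbhd f n , Nbhd-open f n) ∷ [] , refl ∷ [] ,
    λ { {g} (g∈ ∷ []) → subst V (code-≈ n {f} {g} (sym g∈) n ≤-refl) f∈ }
    where
    Value : (f : Carrier (Subspace B₁ Codes)) → ℕ → Pred (Carrier (Pointwise Cantor Two)) 0ℓ
    Value f n g = Func.to g (prefix (code f) n) ≡ Func.to (proj₁ (proj₁ f)) (prefix (code f) n)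
    Value-open : ∀ f n → Open (Pointwise Cantor Two) (Value f n)
    Value-open f n g g∈ =
      (prefix (code f) n , (_≡ Func.to (proj₁ (proj₁ f)) (prefix (code f) n)) , tt) ∷ [] ,
      g∈ ∷ [] , λ { (∈ ∷ []) → ∈ }
    Nbhd : (f : Carrier (Subspace B₁ Codes)) → ℕ → Pred (Carrier B₁) 0ℓ
    Nbhd f n g = Value f n (proj₁ g)
    Nbhd-open : ∀ f n → Open B₁ (Nbhd f n)
    Nbhd-open f n g g∈ = (Value f n , Value-open f n) ∷ [] , g∈ ∷ [] , λ { (∈ ∷ []) → ∈ }

  uncode : (ℕ → ℕ) → Carrier (Subspace B₁ Codes)
  uncode ν = fun₁ (dec ν) , ν , λ _ → refl

  dec-continuous : Continuous (ℕ ^ω) Cantor dec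
  dec-continuous V V-open = cylinders⇒Open λ ν ν∈ →
    let n , ball⊆V = Open⇒cylinder V-open (dec ν) ν∈ in
    n , λ μ ν≈μ → ball⊆V (dec μ) (dec-cong n ν≈μ)

  uncode-continuous : Continuous (ℕ ^ω) (Subspace B₁ Codes) uncode
  uncode-continuous = subbase-continuous (ℕ ^ω) uncode λ (V , V-open) →
    dec-continuous _ (fun₁-continuous V V-open)

  Codes≅ℕ^ω : Homeomorphic (Subspace B₁ Codes) (ℕ ^ω)
  Codes≅ℕ^ω = record
    { to        = code
    ; from      = uncode
    ; to-cong   = λ {f} {g} f≈g n → code-≈ n {f} {g} (f≈g _) n ≤-refl
    ; from-cong = decoded-cong
    ; inverse   =
        (λ {ν} {f} f≈ n → code-≈ n {f} {uncode ν} (f≈ _) n ≤-refl) ,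
        (λ { {_ , μ , ≈f} {ν} ν≗μ x → trans (decoded-cong {ν} {μ} ν≗μ x) (≈f x) })
    } , code-continuous , uncode-continuous
    where
    decoded-cong : ∀ {ν μ} → (∀ n → ν n ≡ μ n) → Space._≈_ B₁ (fun₁ (dec ν)) (fun₁ (dec μ))
    decoded-cong ν≗μ = fun₁-cong λ i → dec-cong (suc i) (λ n _ → ν≗μ n) i ≤-refl

  evaluation-BaireOne : BaireOne (Cantor ×ᵗ Subspace B₁ Codes) Two (evaluation Cantor Two Codes)
  evaluation-BaireOne V _ with F , F-closed , (⊆F , F⊆) ←
    fun-BaireOne (Cantor ×ᵗ Subspace B₁ Codes) proj₁ (dec ∘ code ∘ proj₂)
      (proj₁-continuous Cantor (Subspace B₁ Codes))
      (λ V V-open → proj₂-continuous Cantor (Subspace B₁ Codes) (code ⊢ (dec ⊢ V))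
        (code-continuous (dec ⊢ V) (dec-continuous V V-open)))
      -- No code has a last one, so the constant proposition is true.
      ⊤ (λ (_ , f) _ → dec-¬Last (code f)) (λ _ _ → tt) V tt =
    F , F-closed ,
    (λ { {x , f , ν , ≈f} v → ⊆F {x , f , ν , ≈f} (subst V (sym (≈f x)) v) }) ,
    (λ { {x , f , ν , ≈f} z → subst V (≈f x) (F⊆ {x , f , ν , ≈f} z) })

corollary16 : (em : ∀ {ℓ} → ExcludedMiddle ℓ) →
    (W : ℕ → Pred (Space.Carrier Cantor) 0ℓ) → IsGoodBasis Cantor W →
    let B₁ = 𝓑₁ Cantor Two in
    (Σ (Injection (Space.setoid Cantor) (Space.setoid B₁)) λ I →
    let I[2^ω] = Image Cantor B₁ I in
    Continuous Cantor B₁ (Injection.to I)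
    × ¬ UniformlyRecoverable em Cantor Two W I[2^ω]
    × ¬ BaireOne (Cantor ×ᵗ Subspace B₁ I[2^ω]) Two (evaluation Cantor Two I[2^ω]))
    × (Σ (Pred (Space.Carrier B₁) 0ℓ) λ A →
    A Respects (Space._≈_ B₁)
    × Homeomorphic (Subspace B₁ A) (ℕ ^ω)
    × ¬ UniformlyRecoverable em Cantor Two W A
    × BaireOne (Cantor ×ᵗ Subspace B₁ A) Two (evaluation Cantor Two A))
corollary16 em W gb =
  ( I em , fun₁-continuous em
  , not-uniformly-recoverable em W gb _ (λ ν → dec ν , λ _ → refl)
  , evaluation-not-BaireOne em )
  , Codes em , (λ f≈g (ν , ≈f) → ν , λ x → trans (≈f x) (f≈g x))
  , Codes≅ℕ^ω em
  , not-uniformly-recoverable em W gb _ (λ ν → ν , λ _ → refl)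
  , evaluation-BaireOne em
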